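{- Let $a$ and $n$ be positive integers with $n\ge 2$. Then the equation $ax+y=z^n$ is 2-Ramsey.
   Context: For $k\in\mathbb{Z}^+$, an equation in the variables $x,y,z$ is called $k$-Ramsey if every colouring of the positive integers $\mathbb{Z}^+$ with $k$ colours admits infinitely many monochromatic solutions $(x,y,z)\in(\mathbb{Z}^+)^3$, i.e. solutions with $x,y,z$ all receiving the same colour. -}

module Defs where

open import Data.Nat using (ℕ; _+_; _*_; _^_; _<_; _≥_)
open import Data.Fin using (Fin)
open import Data.Product using (Σ; _×_; _,_; ∃-syntax)
open import Data.List using (List)
open import Data.List.Membership.Propositional using (_∈_)
open import Relation.Binary.PropositionalEquality using (_≡_)
open import Relation.Nullary using (¬_)

Triple : Set
Triple = ℕ × ℕ × ℕ

-- A k-colouring of the positive integers. We use a function on ℕ;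
-- its value at 0 is irrelevant since only positive integers are ever used.
Colouring : ℕ → Set
Colouring k = ℕ → Fin k

Equation : Set₁
Equation = ℕ → ℕ → ℕ → Set

MonoSolution : ∀ {k} → Equation → Colouring k → Triple → Set
MonoSolution E c (x , y , z) =
  (0 < x) × (0 < y) × (0 < z) × E x y z × (c x ≡ c y) × (c y ≡ c z)

InfinitelyManyMono : ∀ {k} → Equation → Colouring k → Set
InfinitelyManyMono E c =
  (L : List Triple) → ∃[ t ] (MonoSolution E c t × ¬ (t ∈ L))

Ramsey : ℕ → Equation → Set
Ramsey k E = (c : Colouring k) → InfinitelyManyMono E c

PowerEq : ℕ → ℕ → Equation
PowerEq a n x y z = a * x + y ≡ z ^ n

{-# OPTIONS --safe #-}

-- Call z and z′ a change if their colours differ, and write zⁿ = a x + y and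
-- z′ⁿ = a (x + p) + y with a p = z′ⁿ − zⁿ. In the absence of solutions, x
-- having the colour of z forces y to have the colour of z′, and then x + p to
-- have the colour of z. So a change makes the colour class of z closed under + p.
--
-- Let b = a (a + 1). If no two consecutive multiples z, z + b differ in colour,
-- there are solutions among the multiples of b. If some z is red and z + b is
-- blue, closure under + p produces, at a much larger scale, multiples
-- w ≤ w′ < w″ of b that are red, blue, red and whose ratios are close to 1.
-- The changes at w, w′ and at w′, w″ close the red class under + p and − q,
-- which is rotation by p modulo p + q on an interval of that length. Hence red
-- is p-periodic. But r = w′ⁿ/(a + 1) is red, since a r + r = w′ⁿ, so r − a p is
-- red, and a r + (r − a p) = wⁿ.

module Submission where

open import Defs
open import Data.Nat using (ℕ; zero; suc; _+_; _*_; _∸_; _^_; _≤_; _<_; _≥_;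
  z≤n; s≤s; NonZero; >-nonZero; >-nonZero⁻¹)
open import Data.Nat.Properties hiding (_≟_)
open import Data.Nat.Divisibility
open import Data.Nat.DivMod
open import Data.Nat.Tactic.RingSolver using (solve-∀)
open import Data.Fin using (Fin; zero; suc)
open import Data.Fin.Properties using (_≟_)
open import Data.Product using (_×_; _,_; proj₂; ∃-syntax)
open import Data.Sum using (_⊎_; inj₁; inj₂)
open import Data.List using (map)
open import Data.List.Extrema.Nat using (max; xs≤max)
open import Data.List.Membership.Propositional using (_∉_)
open import Data.List.Membership.Propositional.Properties using (∈-map⁺)
import Data.List.Relation.Unary.All as All
open import Function using (_∘_)
open import Relation.Binary.PropositionalEquality
open import Relation.Nullary using (yes; no; contradiction)

-- Two colours

fin2-≢-≢⇒≡ : {i j k : Fin 2} → i ≢ k → j ≢ k → i ≡ j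
fin2-≢-≢⇒≡ {zero}     {zero}     _   _   = refl
fin2-≢-≢⇒≡ {suc zero} {suc zero} _   _   = refl
fin2-≢-≢⇒≡ {zero}     {suc zero} {zero}     i≢k _ = contradiction refl i≢k
fin2-≢-≢⇒≡ {zero}     {suc zero} {suc zero} _ j≢k = contradiction refl j≢k
fin2-≢-≢⇒≡ {suc zero} {zero}     {zero}     _ j≢k = contradiction refl j≢k
fin2-≢-≢⇒≡ {suc zero} {zero}     {suc zero} i≢k _ = contradiction refl i≢k

-- Rotation by p modulo p + q

module _ (P : ℕ → Set) (p q : ℕ) .{{_ : NonZero (p + q)}}
         (up   : ∀ t → t < q → P t → P (t + p))
         (down : ∀ t → t < p → P (t + q) → P t) where

  private
    N = p + q

    -- Below `q` the rotation is the step `up`. From `q` on, u = q + v and u + p = v + N, so the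
    -- rotation subtracts `q`, which is the step `down`.
    rotate-residue : ∀ u → u < N → P u → P ((u + p) % N)
    rotate-residue u u<N Pu with u <? q
    ... | yes u<q = subst P (sym (m<n⇒m%n≡m u+p<N)) (up u u<q Pu)
      where
      u+p<N : u + p < N
      u+p<N = subst (u + p <_) (+-comm q p) (+-monoˡ-< p u<q)
    ... | no u≮q with m≤n⇒∃[o]m+o≡n (≮⇒≥ u≮q)
    ...   | v , refl = subst P (sym residue) (down v v<p (subst P (+-comm q v) Pu))
      where
      v<p : v < p
      v<p = +-cancelˡ-< q v p (subst (q + v <_) (+-comm p q) u<N)
      regroup : ∀ q v p → q + v + p ≡ v + (p + q)
      regroup = solve-∀
      residue : (q + v + p) % N ≡ v
      residue = trans (cong (_% N) (regroup q v p))
        (trans ([m+n]%n≡m%n v N) (m<n⇒m%n≡m (<-≤-trans v<p (m≤m+n p q))))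

    rotate : ∀ t → P (t % N) → P ((t + p) % N)
    rotate t Pt = subst P (sym eq) (rotate-residue (t % N) (m%n<n t N) Pt)
      where
      swap : ∀ r k p → r + k + p ≡ r + p + k
      swap = solve-∀
      eq : (t + p) % N ≡ (t % N + p) % N
      eq = trans (cong (λ x → (x + p) % N) (m≡m%n+[m/n]*n t N))
        (trans (cong (_% N) (swap (t % N) (t / N * N) p))
               ([m+kn]%n≡m%n (t % N + p) (t / N) N))

    rotate-multiple : ∀ k → P (p % N) → P ((suc k * p) % N)
    rotate-multiple zero    Pp = subst (λ x → P (x % N)) (sym (+-identityʳ p)) Pp
    rotate-multiple (suc k) Pp =
      subst (λ x → P (x % N)) (+-comm (suc k * p) p) (rotate (suc k * p) (rotate-multiple k Pp))

  -- As 0 < q, the start `p` is its own residue. Then p + q - 1 further rotations lead to the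
  -- residue of (p + q) p, which is 0.
  rotation-closed : 0 < q → P p → P 0
  rotation-closed 0<q Pp with m≤n⇒∃[o]m+o≡n 0<q
  ... | q′ , refl = subst P full-turn (rotate-multiple (p + q′) (subst P (sym p%N≡p) Pp))
    where
    p%N≡p : p % N ≡ p
    p%N≡p = m<n⇒m%n≡m (m<m+n p 0<q)
    commute : ∀ p q′ → suc (p + q′) * p ≡ p * (p + suc q′)
    commute = solve-∀
    full-turn : (suc (p + q′) * p) % N ≡ 0
    full-turn = trans (cong (_% N) (commute p q′)) (m*n%n≡0 p N)

-- Growth of powers

^-bernoulli : ∀ m h n → (m + h) ^ suc n ≤ m ^ suc n + suc n * h * (m + h) ^ n
^-bernoulli m h zero    = ≤-reflexive (lemma m h)
  where
  lemma : ∀ m h → (m + h) * 1 ≡ m * 1 + (h + 0) * 1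
  lemma = solve-∀
^-bernoulli m h (suc n) = begin
  (m + h) * X                                   ≡⟨ *-distribʳ-+ X m h ⟩
  m * X + h * X                                 ≤⟨ +-monoˡ-≤ (h * X) (*-monoʳ-≤ m (^-bernoulli m h n)) ⟩
  m * (m ^ suc n + suc n * h * Y) + h * X       ≡⟨ expand m (m ^ suc n) n h Y X ⟩
  m * m ^ suc n + (h * X + suc n * h * (m * Y)) ≤⟨ +-monoʳ-≤ (m * m ^ suc n) (+-monoʳ-≤ (h * X)
                                                     (*-monoʳ-≤ (suc n * h) (*-monoˡ-≤ Y (m≤m+n m h)))) ⟩
  m * m ^ suc n + (h * X + suc n * h * X)       ≡⟨ collect m (m ^ suc n) n h X ⟩
  m * m ^ suc n + suc (suc n) * h * X           ∎
  where
  open ≤-Reasoning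
  X = (m + h) ^ suc n
  Y = (m + h) ^ n
  expand : ∀ m Z n h Y X → m * (Z + suc n * h * Y) + h * X ≡ m * Z + (h * X + suc n * h * (m * Y))
  expand = solve-∀
  collect : ∀ m Z n h X → m * Z + (h * X + suc n * h * X) ≡ m * Z + suc (suc n) * h * X
  collect = solve-∀

-- The hypothesis makes `suc e` times the error term of `^-bernoulli` at most one copy of the
-- left-hand power, which then cancels.
^-slow-growth : ∀ e m h n → suc e * (n * h) ≤ m → e * (m + h) ^ n ≤ suc e * m ^ n
^-slow-growth e m h zero    _  = m≤n+m (e * 1) 1
^-slow-growth e m h (suc n) le = +-cancelˡ-≤ X _ _ (begin
  suc e * X                                           ≤⟨ *-monoʳ-≤ (suc e) (^-bernoulli m h n) ⟩
  suc e * (m ^ suc n + suc n * h * Y)                 ≡⟨ expand e (m ^ suc n) n h Y ⟩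
  suc e * m ^ suc n + suc e * (suc n * h) * Y         ≤⟨ +-monoʳ-≤ (suc e * m ^ suc n)
                                                           (*-monoˡ-≤ Y (≤-trans le (m≤m+n m h))) ⟩
  suc e * m ^ suc n + X                               ≡⟨ +-comm (suc e * m ^ suc n) X ⟩
  X + suc e * m ^ suc n                               ∎)
  where
  open ≤-Reasoning
  X = (m + h) ^ suc n
  Y = (m + h) ^ n
  expand : ∀ e Z n h Y → suc e * (Z + suc n * h * Y) ≡ suc e * Z + suc e * (suc n * h) * Y
  expand = solve-∀

m≤m^n : ∀ m n .{{_ : NonZero m}} → 1 ≤ n → m ≤ m ^ n
m≤m^n m (suc n) _ = m≤m*n m (m ^ n) {{m^n≢0 m n}}

-- Exponent at least 2 enters here: the gap D between zⁿ and (z + b)ⁿ becomes at least z, which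
-- provides the larger scale.
m^n+m≤[m+h]^n : ∀ m h n .{{_ : NonZero m}} → 1 ≤ h → 2 ≤ n → m ^ n + m ≤ (m + h) ^ n
m^n+m≤[m+h]^n m h (suc n) 1≤h (s≤s 1≤n) = begin
  m * m ^ n + m            ≤⟨ +-monoʳ-≤ (m * m ^ n) (m≤m^n m n 1≤n) ⟩
  m * m ^ n + m ^ n        ≤⟨ +-monoʳ-≤ (m * m ^ n) (m≤n*m (m ^ n) h {{>-nonZero 1≤h}}) ⟩
  m * m ^ n + h * m ^ n    ≡⟨ sym (*-distribʳ-+ (m ^ n) m h) ⟩
  (m + h) * m ^ n          ≤⟨ *-monoʳ-≤ (m + h) (^-monoˡ-≤ n (m≤m+n m h)) ⟩
  (m + h) * (m + h) ^ n    ∎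
  where open ≤-Reasoning

∣m⇒∣m^n : ∀ {d m} n .{{_ : NonZero n}} → d ∣ m → d ∣ m ^ n
∣m⇒∣m^n {m = m} (suc n) d∣m = ∣m⇒∣m*n (m ^ n) d∣m

-- Translations preserving a colour class

-- A stands for the existence of a fresh solution. Keeping it as an explicit
-- alternative, instead of assuming that there is none, is what makes the
-- argument constructive.
module Changes
  (a n M : ℕ) (0<a : 0 < a) (2≤n : 2 ≤ n) (c : Colouring 2) {A : Set}
  (solution : ∀ {x y z} → M ≤ z → 0 < x → 0 < y → PowerEq a n x y z →
              c x ≡ c y → c y ≡ c z → A)
  where

  private
    b = a * suc a

    instance
      n≢0 : NonZero n
      n≢0 = >-nonZero (≤-trans (s≤s z≤n) 2≤n)
      a≢0 : NonZero a
      a≢0 = >-nonZero 0<a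
      b≢0 : NonZero b
      b≢0 = m*n≢0 a (suc a)

  infix 4 _≈_
  _≈_ : ℕ → ℕ → Set
  x ≈ w = A ⊎ c x ≡ c w

  shift : ∀ {w w′ p x} → M ≤ w → M ≤ w′ → c w′ ≢ c w → w′ ^ n ≡ w ^ n + a * p →
          0 < x → a * x < w ^ n → x ≈ w → x + p ≈ w
  shift _ _ _ _ _ _ (inj₁ s) = inj₁ s
  shift {w} {w′} {p} {x} M≤w M≤w′ w′≢w gap 0<x ax<wⁿ (inj₂ x≡w)
    with m≤n⇒∃[o]m+o≡n (<⇒≤ ax<wⁿ)
  ... | y , ax+y≡wⁿ with 0<y ← +-cancelˡ-< (a * x) 0 y
                           (subst₂ _<_ (sym (+-identityʳ (a * x))) (sym ax+y≡wⁿ) ax<wⁿ)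
                    with c y ≟ c w | c (x + p) ≟ c w
  ...   | yes y≡w | _       = inj₁ (solution M≤w 0<x 0<y ax+y≡wⁿ (trans x≡w (sym y≡w)) y≡w)
  ...   | no _    | yes eq  = inj₂ eq
  ...   | no y≢w  | no x+p≢w =
    inj₁ (solution M≤w′ (<-≤-trans 0<x (m≤m+n x p)) 0<y eq
      (fin2-≢-≢⇒≡ x+p≢w y≢w) (fin2-≢-≢⇒≡ y≢w w′≢w))
    where
    regroup : ∀ a x p y → a * (x + p) + y ≡ a * x + y + a * p
    regroup = solve-∀
    eq : a * (x + p) + y ≡ w′ ^ n
    eq = trans (regroup a x p y) (trans (cong (_+ a * p) ax+y≡wⁿ) (sym gap))

  -- If x had the colour of w′, then `shift` for the change at w′, w″ would give x + q that colour
  -- too.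
  unshift : ∀ {w w′ w″ q x} → M ≤ w′ → M ≤ w″ → c w′ ≢ c w → c w″ ≡ c w →
            w″ ^ n ≡ w′ ^ n + a * q → 0 < x → a * x < w′ ^ n → x + q ≈ w → x ≈ w
  unshift _ _ _ _ _ _ _ (inj₁ s) = inj₁ s
  unshift {w} {w′} {w″} {q} {x} M≤w′ M≤w″ w′≢w w″≡w gap 0<x ax<w′ⁿ (inj₂ x+q≡w)
    with c x ≟ c w
  ... | yes x≡w = inj₂ x≡w
  ... | no x≢w with shift M≤w′ M≤w″ (λ w″≡w′ → w′≢w (trans (sym w″≡w′) w″≡w)) gap 0<x ax<w′ⁿ
                      (inj₂ (fin2-≢-≢⇒≡ x≢w w′≢w))
  ...   | inj₁ s      = inj₁ s
  ...   | inj₂ x+q≡w′ = contradiction (trans (sym x+q≡w′) x+q≡w) w′≢w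

  -- Two changes close together

  -- With wⁿ = b Q, the parameter E is Q − a F: then r − a p is s = a E, and no
  -- subtraction occurs.
  module TwoChanges
    {w w′ w″ : ℕ} (M≤w : M ≤ w) (M≤w′ : M ≤ w′) (M≤w″ : M ≤ w″)
    (w′≢w : c w′ ≢ c w) (w″≡w : c w″ ≡ c w)
    (E F G : ℕ) (0<G : 0 < G) (small : suc a * G ≤ E)
    (wⁿ  : w ^ n  ≡ b * (a * F + E))
    (w′ⁿ : w′ ^ n ≡ b * (a * F + E + F))
    (w″ⁿ : w″ ^ n ≡ b * (a * F + E + F + G))
    where

    private
      p = suc a * F
      q = suc a * G
      s = a * E

      0<q : 0 < q
      0<q = *-mono-< {0} {suc a} (s≤s z≤n) 0<G

      0<s : 0 < s
      0<s = *-mono-< 0<a (<-≤-trans 0<q small)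

      gap : ∀ {v v′} {e f} → v ^ n ≡ b * e → v′ ^ n ≡ b * (e + f) →
            v′ ^ n ≡ v ^ n + a * (suc a * f)
      gap {e = e} {f} v v′ = trans v′ (trans (regroup a e f) (cong (_+ a * (suc a * f)) (sym v)))
        where
        regroup : ∀ a e f → a * suc a * (e + f) ≡ a * suc a * e + a * (suc a * f)
        regroup = solve-∀

    up : ∀ {x} → 0 < x → x < s + a * p + E → x ≈ w → x + p ≈ w
    up {x} 0<x x< = shift M≤w M≤w′ w′≢w (gap wⁿ w′ⁿ) 0<x
      (subst (a * x <_) (trans (regroup a E F) (sym wⁿ)) (*-monoʳ-< a x<))
      where
      regroup : ∀ a E F → a * (a * E + a * (suc a * F) + E) ≡ a * suc a * (a * F + E)
      regroup = solve-∀

    down : ∀ {x} → 0 < x → x < s + a * p → x + q ≈ w → x ≈ w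
    down {x} 0<x x< = unshift M≤w′ M≤w″ w′≢w w″≡w (gap w′ⁿ w″ⁿ) 0<x
      (subst (a * x <_) (sym w′ⁿ) (begin-strict
        a * x                                        <⟨ *-monoʳ-< a x< ⟩
        a * (s + a * p)                              ≤⟨ m≤m+n _ (a * (E + p)) ⟩
        a * (s + a * p) + a * (E + p)                ≡⟨ regroup a E F ⟩
        b * (a * F + E + F)                          ∎))
      where
      open ≤-Reasoning
      regroup : ∀ a E F → a * (a * E + a * (suc a * F)) + a * (E + suc a * F)
                          ≡ a * suc a * (a * F + E + F)
      regroup = solve-∀

    -- One subtraction of p, by rotation on the interval of length p + q that starts at s + j p. At
    -- its top index j = a - 1 the bound on `down` is just reached; `small` says q ≤ E, which keeps
    -- the steps `up` in range.
    descend : ∀ j → j < a → s + suc j * p ≈ w → s + j * p ≈ w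
    descend j j<a red = subst (_≈ w) (+-identityʳ _)
      (rotation-closed (λ t → s + j * p + t ≈ w) p q {{>-nonZero (<-≤-trans 0<q (m≤n+m q p))}}
        (λ t t<q → subst (_≈ w) (+-assoc (s + j * p) t p)
                 ∘ up (positive t) (+-mono-≤-< (+-monoʳ-≤ s (*-monoˡ-≤ p (<⇒≤ j<a)))
                                               (<-≤-trans t<q small)))
        (λ t t<p → down (positive t) (subst₂ _<_ (sym (+-assoc s (j * p) t)) refl
                     (+-monoʳ-< s (<-≤-trans (subst (j * p + t <_) (+-comm (j * p) p)
                                                (+-monoʳ-< (j * p) t<p))
                                             (*-monoˡ-≤ p j<a))))
                 ∘ subst (_≈ w) (sym (+-assoc (s + j * p) t q)))
        0<q (subst (_≈ w) (regroup s j p) red))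
      where
      positive : ∀ t → 0 < s + j * p + t
      positive t = <-≤-trans 0<s (≤-trans (m≤m+n s (j * p)) (m≤m+n _ t))
      regroup : ∀ s j p → s + suc j * p ≡ s + j * p + p
      regroup = solve-∀

    descend-all : ∀ j → j ≤ a → s + j * p ≈ w → s ≈ w
    descend-all zero    _   = subst (_≈ w) (+-identityʳ s)
    descend-all (suc j) j<a = descend-all j (<⇒≤ j<a) ∘ descend j j<a

    -- Here r = w′ⁿ/(a + 1) is `s + a * p`. The solution is (r, r, w′) if r has the colour of w′;
    -- otherwise `descend-all` leads to (r, s, w).
    two-changes⇒solution : A
    two-changes⇒solution with c (s + a * p) ≟ c w
    ... | no r≢w = solution M≤w′ 0<r 0<r (trans (fixed a E F) (sym w′ⁿ)) refl
                     (fin2-≢-≢⇒≡ r≢w w′≢w)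
      where
      0<r : 0 < s + a * p
      0<r = <-≤-trans 0<s (m≤m+n s (a * p))
      fixed : ∀ a E F → a * (a * E + a * (suc a * F)) + (a * E + a * (suc a * F))
                        ≡ a * suc a * (a * F + E + F)
      fixed = solve-∀
    ... | yes r≡w with descend-all a ≤-refl (inj₂ r≡w)
    ...   | inj₁ sol = sol
    ...   | inj₂ s≡w = solution M≤w (<-≤-trans 0<s (m≤m+n s (a * p))) 0<s
                         (trans (regroup a E F) (sym wⁿ)) (trans r≡w (sym s≡w)) s≡w
      where
      regroup : ∀ a E F → a * (a * E + a * (suc a * F)) + a * E ≡ a * suc a * (a * F + E)
      regroup = solve-∀

  -- Divided by b, closeness reads (a + 1)(F + G) ≤ Q. So E = Q - a F exists and is at least F + (a
  -- + 1) G, which contains `small`.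
  close-changes⇒solution : ∀ {w w′ w″} → M ≤ w → w ≤ w′ → w′ < w″ →
    c w′ ≢ c w → c w″ ≡ c w → b ∣ w → b ∣ w′ → b ∣ w″ →
    suc a * w″ ^ n ≤ suc (suc a) * w ^ n → A
  close-changes⇒solution {w} {w′} {w″} M≤w w≤w′ w′<w″ w′≢w w″≡w b∣w b∣w′ b∣w″ close
    with divides Q  wⁿ  ← ∣m⇒∣m^n n b∣w
       | divides Q′ w′ⁿ ← ∣m⇒∣m^n n b∣w′
       | divides Q″ w″ⁿ ← ∣m⇒∣m^n n b∣w″
    with F , refl ← m≤n⇒∃[o]m+o≡n (*-cancelʳ-≤ Q Q′ b (subst₂ _≤_ wⁿ w′ⁿ (^-monoˡ-≤ n w≤w′)))
    with Q+F<Q″ ← *-cancelʳ-< b (Q + F) Q″ (subst₂ _<_ w′ⁿ w″ⁿ (^-monoˡ-< n w′<w″))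
    with G , refl ← m≤n⇒∃[o]m+o≡n (<⇒≤ Q+F<Q″)
    = finish (m≤n⇒∃[o]m+o≡n (≤-trans (m≤m+n (a * F) _) aF+aG≤Q))
    where
    open ≤-Reasoning
    expand : ∀ a Q F G → suc a * Q + (a * F + (F + suc a * G)) ≡ suc a * (Q + F + G)
    expand = solve-∀
    aF+aG≤Q : a * F + (F + suc a * G) ≤ Q
    aF+aG≤Q = +-cancelˡ-≤ (suc a * Q) _ _ (*-cancelʳ-≤ _ _ b (begin
      (suc a * Q + (a * F + (F + suc a * G))) * b  ≡⟨ cong (_* b) (expand a Q F G) ⟩
      suc a * (Q + F + G) * b                      ≡⟨ *-assoc (suc a) (Q + F + G) b ⟩
      suc a * ((Q + F + G) * b)                    ≡⟨ cong (suc a *_) (sym w″ⁿ) ⟩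
      suc a * w″ ^ n                               ≤⟨ close ⟩
      suc (suc a) * w ^ n                          ≡⟨ cong (suc (suc a) *_) wⁿ ⟩
      suc (suc a) * (Q * b)                        ≡⟨ sym (*-assoc (suc (suc a)) Q b) ⟩
      suc (suc a) * Q * b                          ≡⟨ cong (_* b) (+-comm Q (suc a * Q)) ⟩
      (suc a * Q + Q) * b                          ∎))
    0<G : 0 < G
    0<G = +-cancelˡ-< (Q + F) 0 G (subst (_< Q + F + G) (sym (+-identityʳ (Q + F))) Q+F<Q″)
    finish : ∃[ E ] a * F + E ≡ Q → A
    finish (E , aF+E≡Q) = TwoChanges.two-changes⇒solution M≤w M≤w′ (≤-trans M≤w′ (<⇒≤ w′<w″))
      w′≢w w″≡w E F G 0<G
      (≤-trans (m≤n+m (suc a * G) F)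
        (+-cancelˡ-≤ (a * F) _ _ (subst (_ ≤_) (sym aF+E≡Q) aF+aG≤Q)))
      (rewritten (λ Q → Q) wⁿ) (rewritten (_+ F) w′ⁿ) (rewritten (λ Q → Q + F + G) w″ⁿ)
      where
      M≤w′ : M ≤ w′
      M≤w′ = ≤-trans M≤w w≤w′
      rewritten : ∀ {v} (f : ℕ → ℕ) → v ≡ f Q * b → v ≡ b * f (a * F + E)
      rewritten f eq = trans eq (trans (*-comm (f Q) b) (cong (λ Q → b * f Q) (sym aF+E≡Q)))

  -- From one change to two close ones

  private
    -- C * D = (2 + a) * (n * h) for the width h = 2 * D of the window in which
    -- the three numbers w, w′, w″ are found.
    C K : ℕ
    C = suc (suc a) * (n * 2)
    K = suc (a * (3 + C))

  -- With D = (z + b)ⁿ - zⁿ and d = D/a, repeated shifts give every z + j d in range the colour of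
  -- z. Two of these serve as w = z + C D and w″ = z + (2 + C) D. Between them lies some y = zⁿ - a
  -- x with x = z + i d; it has the other colour, unless (x, y, z) is a solution, and serves as w′.
  adjacent-change⇒solution : ∀ {z} → M ≤ z → 0 < z → b ∣ z → suc K * (n * b) ≤ z →
                             c (z + b) ≢ c z → A
  adjacent-change⇒solution {z} M≤z 0<z b∣z large z+b≢z
    with D , zⁿ+D ← m≤n⇒∃[o]m+o≡n (^-monoˡ-≤ n (m≤m+n z b))
    with divides e D≡e*b ← ∣m+n∣m⇒∣n {m = z ^ n} (subst (b ∣_) (sym zⁿ+D)
                             (∣m⇒∣m^n n (∣m∣n⇒∣m+n b∣z ∣-refl))) (∣m⇒∣m^n n b∣z)
    = finish
    where
    open ≤-Reasoning
    d = suc a * e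

    D≡a*d : D ≡ a * d
    D≡a*d = trans D≡e*b (regroup a e)
      where
      regroup : ∀ a e → e * (a * suc a) ≡ a * (suc a * e)
      regroup = solve-∀

    b∣D : b ∣ D
    b∣D = divides e D≡e*b

    z≤D : z ≤ D
    z≤D = +-cancelˡ-≤ (z ^ n) z D (subst (z ^ n + z ≤_) (sym zⁿ+D)
            (m^n+m≤[m+h]^n z b n {{>-nonZero 0<z}} (>-nonZero⁻¹ b) 2≤n))

    0<D : 0 < D
    0<D = <-≤-trans 0<z z≤D

    instance
      D≢0 : NonZero D
      D≢0 = >-nonZero 0<D

    K*D≤zⁿ : K * D ≤ z ^ n
    K*D≤zⁿ = +-cancelˡ-≤ (K * z ^ n) _ _ (begin
      K * z ^ n + K * D     ≡⟨ sym (*-distribˡ-+ K (z ^ n) D) ⟩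
      K * (z ^ n + D)       ≡⟨ cong (K *_) zⁿ+D ⟩
      K * (z + b) ^ n       ≤⟨ ^-slow-growth K z b n large ⟩
      suc K * z ^ n         ≡⟨ +-comm (z ^ n) (K * z ^ n) ⟩
      K * z ^ n + z ^ n     ∎)

    -- This is what `K` is chosen for: after z ≤ D, the left side is at most (K - 1) D.
    room : a * (z + (2 + C) * D) < z ^ n
    room = begin-strict
      a * (z + (2 + C) * D)  ≤⟨ *-monoʳ-≤ a (+-monoˡ-≤ _ z≤D) ⟩
      a * (D + (2 + C) * D)  ≡⟨ sym (*-assoc a (3 + C) D) ⟩
      a * (3 + C) * D        <⟨ m<n+m (a * (3 + C) * D) 0<D ⟩
      K * D                  ≤⟨ K*D≤zⁿ ⟩
      z ^ n                  ∎

    progression : ∀ j → a * (z + j * d) < z ^ n → z + j * d ≈ z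
    progression zero    _  = inj₂ (cong c (+-identityʳ z))
    progression (suc j) lt = subst (_≈ z) (regroup z j d)
      (shift M≤z (≤-trans M≤z (m≤m+n z b)) z+b≢z
        (trans (sym zⁿ+D) (cong (z ^ n +_) D≡a*d))
        (<-≤-trans 0<z (m≤m+n z _)) prev (progression j prev))
      where
      regroup : ∀ z j d → z + j * d + d ≡ z + suc j * d
      regroup = solve-∀
      prev : a * (z + j * d) < z ^ n
      prev = ≤-<-trans (*-monoʳ-≤ a (+-monoʳ-≤ z (m≤n+m (j * d) d))) lt

    multiple : ∀ k → k ≤ 2 + C → z + k * D ≈ z
    multiple k k≤ = subst (_≈ z) (sym eq) (progression (k * a)
      (≤-<-trans (*-monoʳ-≤ a (≤-trans (≤-reflexive (sym eq)) (+-monoʳ-≤ z (*-monoˡ-≤ D k≤)))) room))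
      where
      eq : z + k * D ≡ z + k * a * d
      eq = cong (z +_) (trans (cong (k *_) D≡a*d) (sym (*-assoc k a d)))

    remainder : ∃[ U ] (a * z + suc C * D) + U ≡ z ^ n
    remainder = m≤n⇒∃[o]m+o≡n (begin
      a * z + suc C * D          ≤⟨ +-monoʳ-≤ (a * z) (≤-trans (m≤n+m _ D) (m≤n*m _ a)) ⟩
      a * z + a * ((2 + C) * D)  ≡⟨ sym (*-distribˡ-+ a z _) ⟩
      a * (z + (2 + C) * D)      ≤⟨ <⇒≤ room ⟩
      z ^ n                      ∎)

    finish : A
    finish with U , eq ← remainder = conclude (progression i ax<zⁿ) (multiple C (m≤n+m C 2))
                                                (multiple (2 + C) ≤-refl)
      where
      -- Raising i by one lowers y by a d = D. Dividing U by D therefore puts y in [(C + 1) D, (C +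
      -- 2) D), which lies between w and w″ because z ≤ D.
      i = U / D
      x = z + i * d
      y = suc C * D + U % D

      ax+y≡zⁿ : a * x + y ≡ z ^ n
      ax+y≡zⁿ = begin-equality
        a * (z + i * d) + (suc C * D + U % D)      ≡⟨ regroup a z i d (suc C * D) (U % D) ⟩
        a * z + suc C * D + (U % D + i * (a * d))  ≡⟨ cong (λ t → a * z + suc C * D + (U % D + i * t)) (sym D≡a*d) ⟩
        a * z + suc C * D + (U % D + i * D)        ≡⟨ cong (a * z + suc C * D +_) (sym (m≡m%n+[m/n]*n U D)) ⟩
        a * z + suc C * D + U                      ≡⟨ eq ⟩
        z ^ n                                      ∎
        where
        regroup : ∀ a z i d t r → a * (z + i * d) + (t + r) ≡ a * z + t + (r + i * (a * d))
        regroup = solve-∀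

      0<y : 0 < y
      0<y = <-≤-trans 0<D (≤-trans (m≤m+n D (C * D)) (m≤m+n _ (U % D)))

      ax<zⁿ : a * x < z ^ n
      ax<zⁿ = subst (a * x <_) ax+y≡zⁿ (m<m+n (a * x) 0<y)

      b∣y : b ∣ y
      b∣y = ∣m+n∣m⇒∣n (subst (b ∣_) (sym ax+y≡zⁿ) (∣m⇒∣m^n n b∣z))
              (subst (b ∣_) (sym ax≡) (∣m∣n⇒∣m+n (∣n⇒∣m*n a b∣z) (∣n⇒∣m*n i b∣D)))
        where
        regroup : ∀ a z i d → a * (z + i * d) ≡ a * z + i * (a * d)
        regroup = solve-∀
        ax≡ : a * x ≡ a * z + i * D
        ax≡ = trans (regroup a z i d) (cong (λ t → a * z + i * t) (sym D≡a*d))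

      window : suc (suc a) * (n * (2 * D)) ≤ z + C * D
      window = ≤-trans (≤-reflexive (regroup (suc (suc a)) n D)) (m≤n+m (C * D) z)
        where
        regroup : ∀ k n D → k * (n * (2 * D)) ≡ k * (n * 2) * D
        regroup = solve-∀

      conclude : x ≈ z → z + C * D ≈ z → z + (2 + C) * D ≈ z → A
      conclude (inj₁ s) _ _ = s
      conclude _ (inj₁ s) _ = s
      conclude _ _ (inj₁ s) = s
      conclude (inj₂ x≡z) (inj₂ w≡z) (inj₂ w″≡z) with c y ≟ c z
      ... | yes y≡z = solution M≤z (<-≤-trans 0<z (m≤m+n z _)) 0<y ax+y≡zⁿ
                        (trans x≡z (sym y≡z)) y≡z
      ... | no y≢z  = close-changes⇒solution (≤-trans M≤z (m≤m+n z _))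
        (≤-trans (+-monoˡ-≤ (C * D) z≤D) (m≤m+n _ (U % D)))
        (<-≤-trans (+-monoʳ-< (suc C * D) (m%n<n U D))
          (≤-trans (≤-reflexive (+-comm (suc C * D) D)) (m≤n+m _ z)))
        (λ y≡w → y≢z (trans y≡w w≡z)) (trans w″≡z (sym w≡z))
        (∣m∣n⇒∣m+n b∣z (∣n⇒∣m*n C b∣D)) b∣y (∣m∣n⇒∣m+n b∣z (∣n⇒∣m*n (2 + C) b∣D))
        (subst (λ t → suc a * t ^ n ≤ suc (suc a) * (z + C * D) ^ n) (regroup z C D)
          (^-slow-growth (suc a) (z + C * D) (2 * D) n window))
        where
        regroup : ∀ z C D → z + C * D + 2 * D ≡ z + (2 + C) * D
        regroup = solve-∀

  -- Constant colour on large multiples of b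

  fresh-solution : A
  fresh-solution = finish constant
    where
    threshold m z₀ : ℕ
    threshold = suc K * (n * b)
    -- Every b (m + j) is then positive, at least `M`, and large enough for
    -- `adjacent-change⇒solution`.
    m = suc (M + threshold)
    z₀ = b * m

    below : ∀ j → m ≤ b * (m + j)
    below j = ≤-trans (m≤m+n m j) (m≤n*m (m + j) b)

    M≤ : ∀ j → M ≤ b * (m + j)
    M≤ j = ≤-trans (≤-trans (m≤m+n M threshold) (n≤1+n (M + threshold))) (below j)

    constant : ∀ j → b * (m + j) ≈ z₀
    constant zero = inj₂ (cong (c ∘ (b *_)) (+-identityʳ m))
    constant (suc j) with constant j
    ... | inj₁ s  = inj₁ s
    ... | inj₂ eq with c (b * (m + j) + b) ≟ c (b * (m + j))
    ...   | yes same = inj₂ (trans (cong c (regroup b m j)) (trans same eq))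
      where
      regroup : ∀ b m j → b * (m + suc j) ≡ b * (m + j) + b
      regroup = solve-∀
    ...   | no change = inj₁ (adjacent-change⇒solution (M≤ j) (≤-trans (s≤s z≤n) (below j))
              (m∣m*n (m + j)) (≤-trans (≤-trans (m≤n+m threshold M) (n≤1+n (M + threshold))) (below j)) change)

    1≤n∸1 : 1 ≤ n ∸ 1
    1≤n∸1 = ∸-monoˡ-≤ 1 2≤n

    instance
      z₀≢0 : NonZero z₀
      z₀≢0 = m*n≢0 b m

    -- For x = z = z₀ the equation forces y = z₀ (z₀ⁿ⁻¹ - a) = z₀ (1 + i). This is b (m + m i), one
    -- of the multiples coloured like z₀.
    excess : ∃[ i ] suc a + i ≡ z₀ ^ (n ∸ 1)
    excess = m≤n⇒∃[o]m+o≡n (≤-trans (≤-trans (m≤n*m (suc a) a) (m≤m*n b m)) (m≤m^n z₀ (n ∸ 1) 1≤n∸1))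

    finish : (∀ j → b * (m + j) ≈ z₀) → A
    finish const with i , eq ← excess with const (m * i)
    ... | inj₁ s = s
    ... | inj₂ y≡z = solution (subst (λ t → M ≤ b * t) (+-identityʳ m) (M≤ 0))
            (>-nonZero⁻¹ z₀) (≤-trans (s≤s z≤n) (below (m * i)))
            (begin-equality
              a * z₀ + b * (m + m * i)   ≡⟨ regroup a b m i ⟩
              z₀ * (suc a + i)           ≡⟨ cong (z₀ *_) eq ⟩
              z₀ ^ suc (n ∸ 1)           ≡⟨ cong (z₀ ^_) (m+[n∸m]≡n (≤-trans (s≤s z≤n) 2≤n)) ⟩
              z₀ ^ n                     ∎)
            (sym y≡z) y≡z
      where
      open ≤-Reasoning
      regroup : ∀ a b m i → a * (b * m) + b * (m + m * i) ≡ b * m * (suc a + i)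
      regroup = solve-∀

-- Infinitely many solutions

theorem1p2 : (a n : ℕ) → 0 < a → n ≥ 2 → Ramsey 2 (PowerEq a n)
theorem1p2 a n 0<a n≥2 c L =
  Changes.fresh-solution a n M 0<a n≥2 c λ {x} {y} {z} M≤z 0<x 0<y eq x≡y y≡z →
    (x , y , z) , (0<x , 0<y , ≤-trans (s≤s z≤n) M≤z , eq , x≡y , y≡z) , fresh M≤z
  where
  third : Triple → ℕ
  third = proj₂ ∘ proj₂
  -- Any z ≥ M exceeds the third entry of every listed triple; the successor also makes z positive.
  M = suc (max 0 (map third L))
  fresh : ∀ {t} → M ≤ third t → t ∉ L
  fresh M≤t t∈L = <⇒≱ M≤t (All.lookup (xs≤max 0 (map third L)) (∈-map⁺ third t∈L))
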